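{- Let $\ell:K(H\times\mathrm{Id})\to HM$ be an abstract GSOS rule with $\ell$-interpretation $b:KC\to C$. Then every sandwiched $\ell$-equation $e:X\to MHMX$ has a unique solution in $C$, i.e. there is a unique morphism $e^\dagger:X\to C$ such that $$e^\dagger = b^\sharp\cdot Mc^{ -1}\cdot MHb^\sharp\cdot MHMe^\dagger\cdot e.$$
   Context: Let $\mathcal A$ be a category with binary products and coproducts, let $H:\mathcal A\to\mathcal A$ be a functor with a terminal coalgebra $c:C\to HC$ (so $c$ is an isomorphism by Lambek's lemma), and let $K:\mathcal A\to\mathcal A$ be a functor such that every object $X$ has a free $K$-algebra $\varphi_X:KMX\to MX$ with universal morphism $\eta_X:X\to MX$. Then $(M,\eta,\mu)$ is the free monad on $K$, where $\mu_X:MMX\to MX$ is the unique $K$-algebra homomorphism $(MMX,\varphi_{MX})\to(MX,\varphi_X)$ with $\mu_X\cdot\eta_{MX}=\mathrm{id}_{MX}$, and $\kappa=\varphi\cdot K\eta:K\to M$. For a $K$-algebra $a:KA\to A$ let $a^\sharp:MA\to A$ be the unique $K$-algebra homomorphism with $a^\sharp\cdot\eta_A=\mathrm{id}_A$; it is an Eilenberg–Moore algebra for $M$ and $a=a^\sharp\cdot\kappa_A$. An abstract GSOS rule is a natural transformation $\ell:K(H\times\mathrm{Id})\to HM$; its $\ell$-interpretation is the unique morphism $b:KC\to C$ with $c\cdot b=Hb^\sharp\cdot\ell_C\cdot K\langle c,\mathrm{id}_C\rangle$ (it exists and is unique). A sandwiched $\ell$-equation is any morphism $e:X\to MHMX$.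 -}

module Defs where

open import Level using (Level; _⊔_; suc)
open import Relation.Binary using (Rel; IsEquivalence; Setoid)
import Relation.Binary.Reasoning.Setoid as SetoidReasoning

private
  variable
    o h r o′ h′ r′ : Level

-- Hom-sets are setoids: equality of morphisms is _≈_.
record Category (o h r : Level) : Set (suc (o ⊔ h ⊔ r)) where
  infix  4 _≈_ _⇒_
  infixr 9 _·_
  field
    Obj : Set o
    _⇒_ : Rel Obj h
    _≈_ : ∀ {A B} → Rel (A ⇒ B) r
    id  : ∀ {A} → A ⇒ A
    _·_ : ∀ {A B C} → B ⇒ C → A ⇒ B → A ⇒ C
    equiv     : ∀ {A B} → IsEquivalence (_≈_ {A} {B})
    assoc     : ∀ {A B C D} {f : A ⇒ B} {g : B ⇒ C} {k : C ⇒ D} →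
                (k · g) · f ≈ k · (g · f)
    identityˡ : ∀ {A B} {f : A ⇒ B} → id · f ≈ f
    identityʳ : ∀ {A B} {f : A ⇒ B} → f · id ≈ f
    ·-resp-≈  : ∀ {A B C} {f f′ : B ⇒ C} {g g′ : A ⇒ B} →
                f ≈ f′ → g ≈ g′ → f · g ≈ f′ · g′

  module Equiv {A B : Obj} = IsEquivalence (equiv {A} {B})

  homSetoid : Obj → Obj → Setoid h r
  homSetoid A B = record { Carrier = A ⇒ B ; _≈_ = _≈_ ; isEquivalence = equiv }

  module HomReasoning {A B : Obj} = SetoidReasoning (homSetoid A B)

  ·-resp-≈ˡ : ∀ {A B C} {f f′ : B ⇒ C} {g : A ⇒ B} → f ≈ f′ → f · g ≈ f′ · g
  ·-resp-≈ˡ p = ·-resp-≈ p Equiv.refl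

  ·-resp-≈ʳ : ∀ {A B C} {f : B ⇒ C} {g g′ : A ⇒ B} → g ≈ g′ → f · g ≈ f · g′
  ·-resp-≈ʳ p = ·-resp-≈ Equiv.refl p

record Functor (𝒜 : Category o h r) (ℬ : Category o′ h′ r′)
               : Set (o ⊔ h ⊔ r ⊔ o′ ⊔ h′ ⊔ r′) where
  private
    module 𝒜 = Category 𝒜
    module ℬ = Category ℬ
  field
    F₀ : 𝒜.Obj → ℬ.Obj
    F₁ : ∀ {A B} → A 𝒜.⇒ B → F₀ A ℬ.⇒ F₀ B
    F-resp-≈     : ∀ {A B} {f g : A 𝒜.⇒ B} → f 𝒜.≈ g → F₁ f ℬ.≈ F₁ g
    identity     : ∀ {A} → F₁ (𝒜.id {A}) ℬ.≈ ℬ.id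
    homomorphism : ∀ {A B C} {f : A 𝒜.⇒ B} {g : B 𝒜.⇒ C} →
                   F₁ (g 𝒜.· f) ℬ.≈ F₁ g ℬ.· F₁ f

Endofunctor : Category o h r → Set (o ⊔ h ⊔ r)
Endofunctor 𝒜 = Functor 𝒜 𝒜

record NaturalTransformation {𝒜 : Category o h r} {ℬ : Category o′ h′ r′}
                             (F G : Functor 𝒜 ℬ)
                             : Set (o ⊔ h ⊔ h′ ⊔ r′) where
  private
    module 𝒜 = Category 𝒜
    module F = Functor F
    module G = Functor G
  open Category ℬ
  field
    component : ∀ A → F.F₀ A ⇒ G.F₀ A
    natural   : ∀ {A B} (f : A 𝒜.⇒ B) → component B · F.F₁ f ≈ G.F₁ f · component A

module _ {𝒜 : Category o h r} where
  open Category 𝒜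

  Id : Endofunctor 𝒜
  Id = record
    { F₀ = λ A → A
    ; F₁ = λ f → f
    ; F-resp-≈ = λ p → p
    ; identity = Equiv.refl
    ; homomorphism = Equiv.refl
    }

  infixr 9 _∘F_

  _∘F_ : Endofunctor 𝒜 → Endofunctor 𝒜 → Endofunctor 𝒜
  G ∘F F = record
    { F₀ = λ A → G.F₀ (F.F₀ A)
    ; F₁ = λ f → G.F₁ (F.F₁ f)
    ; F-resp-≈ = λ p → G.F-resp-≈ (F.F-resp-≈ p)
    ; identity = Equiv.trans (G.F-resp-≈ F.identity) G.identity
    ; homomorphism = Equiv.trans (G.F-resp-≈ F.homomorphism) G.homomorphism
    }
    where
      module F = Functor F
      module G = Functor G

record BinaryProducts (𝒜 : Category o h r) : Set (o ⊔ h ⊔ r) where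
  open Category 𝒜
  infixr 7 _×_
  field
    _×_     : Obj → Obj → Obj
    π₁      : ∀ {A B} → A × B ⇒ A
    π₂      : ∀ {A B} → A × B ⇒ B
    ⟨_,_⟩   : ∀ {A B Z} → Z ⇒ A → Z ⇒ B → Z ⇒ A × B
    project₁ : ∀ {A B Z} {f : Z ⇒ A} {g : Z ⇒ B} → π₁ · ⟨ f , g ⟩ ≈ f
    project₂ : ∀ {A B Z} {f : Z ⇒ A} {g : Z ⇒ B} → π₂ · ⟨ f , g ⟩ ≈ g
    unique   : ∀ {A B Z} {f : Z ⇒ A} {g : Z ⇒ B} {k : Z ⇒ A × B} →
               π₁ · k ≈ f → π₂ · k ≈ g → ⟨ f , g ⟩ ≈ k

  infixr 7 _×₁_
  _×₁_ : ∀ {A A′ B B′} → A ⇒ A′ → B ⇒ B′ → A × B ⇒ A′ × B′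
  f ×₁ g = ⟨ f · π₁ , g · π₂ ⟩

  infixr 7 _×F_
  _×F_ : Endofunctor 𝒜 → Endofunctor 𝒜 → Endofunctor 𝒜
  F ×F G = record
    { F₀ = λ A → F.F₀ A × G.F₀ A
    ; F₁ = λ f → F.F₁ f ×₁ G.F₁ f
    ; F-resp-≈ = λ p → unique
        (Equiv.trans project₁ (·-resp-≈ˡ (F.F-resp-≈ (Equiv.sym p))))
        (Equiv.trans project₂ (·-resp-≈ˡ (G.F-resp-≈ (Equiv.sym p))))
    ; identity = unique
        (Equiv.trans identityʳ (Equiv.sym (Equiv.trans (·-resp-≈ˡ F.identity) identityˡ)))
        (Equiv.trans identityʳ (Equiv.sym (Equiv.trans (·-resp-≈ˡ G.identity) identityˡ)))
    ; homomorphism = unique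
        (Equiv.trans (slide project₁ project₁) (·-resp-≈ˡ (Equiv.sym F.homomorphism)))
        (Equiv.trans (slide project₂ project₂) (·-resp-≈ˡ (Equiv.sym G.homomorphism)))
    }
    where
      module F = Functor F
      module G = Functor G
      slide : ∀ {P Q R A B C} {p : P ⇒ A} {q : Q ⇒ B} {s : R ⇒ C}
                {f : A ⇒ B} {g : B ⇒ C} {u : P ⇒ Q} {v : Q ⇒ R} →
              s · v ≈ g · q → q · u ≈ f · p → s · (v · u) ≈ (g · f) · p
      slide {p = p} {q} {s} {f} {g} {u} {v} sv qu = begin
        s · (v · u) ≈⟨ assoc ⟨
        (s · v) · u ≈⟨ ·-resp-≈ˡ sv ⟩
        (g · q) · u ≈⟨ assoc ⟩
        g · (q · u) ≈⟨ ·-resp-≈ʳ qu ⟩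
        g · (f · p) ≈⟨ assoc ⟨
        (g · f) · p ∎
        where open HomReasoning

record BinaryCoproducts (𝒜 : Category o h r) : Set (o ⊔ h ⊔ r) where
  open Category 𝒜
  infixr 6 _+_
  field
    _+_     : Obj → Obj → Obj
    i₁      : ∀ {A B} → A ⇒ A + B
    i₂      : ∀ {A B} → B ⇒ A + B
    [_,_]   : ∀ {A B Z} → A ⇒ Z → B ⇒ Z → A + B ⇒ Z
    inject₁ : ∀ {A B Z} {f : A ⇒ Z} {g : B ⇒ Z} → [ f , g ] · i₁ ≈ f
    inject₂ : ∀ {A B Z} {f : A ⇒ Z} {g : B ⇒ Z} → [ f , g ] · i₂ ≈ g
    unique  : ∀ {A B Z} {f : A ⇒ Z} {g : B ⇒ Z} {k : A + B ⇒ Z} →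
              k · i₁ ≈ f → k · i₂ ≈ g → [ f , g ] ≈ k

module _ {𝒜 : Category o h r} (F : Endofunctor 𝒜) where
  open Category 𝒜
  open Functor F

  IsAlgebraHom : ∀ {A B} → F₀ A ⇒ A → F₀ B ⇒ B → A ⇒ B → Set r
  IsAlgebraHom a b f = f · a ≈ b · F₁ f

  IsCoalgebraHom : ∀ {A B} → A ⇒ F₀ A → B ⇒ F₀ B → A ⇒ B → Set r
  IsCoalgebraHom a b f = b · f ≈ F₁ f · a

record TerminalCoalgebra {𝒜 : Category o h r} (H : Endofunctor 𝒜) : Set (o ⊔ h ⊔ r) where
  open Category 𝒜
  private module H = Functor H
  field
    C : Obj
    c : C ⇒ H.F₀ C
    unfold        : ∀ {A} → A ⇒ H.F₀ A → A ⇒ C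
    unfold-hom    : ∀ {A} (a : A ⇒ H.F₀ A) → IsCoalgebraHom H a c (unfold a)
    unfold-unique : ∀ {A} (a : A ⇒ H.F₀ A) {f : A ⇒ C} →
                    IsCoalgebraHom H a c f → unfold a ≈ f

  -- Lambek's lemma.
  c⁻¹ : H.F₀ C ⇒ C
  c⁻¹ = unfold (H.F₁ c)

  c⁻¹·c≈id : c⁻¹ · c ≈ id
  c⁻¹·c≈id = Equiv.trans (Equiv.sym (unfold-unique c hom)) (unfold-unique c idHom)
    where
      open HomReasoning
      hom : c · (c⁻¹ · c) ≈ H.F₁ (c⁻¹ · c) · c
      hom = begin
        c · (c⁻¹ · c)            ≈⟨ assoc ⟨
        (c · c⁻¹) · c            ≈⟨ ·-resp-≈ˡ (unfold-hom (H.F₁ c)) ⟩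
        (H.F₁ c⁻¹ · H.F₁ c) · c  ≈⟨ ·-resp-≈ˡ H.homomorphism ⟨
        H.F₁ (c⁻¹ · c) · c       ∎
      idHom : c · id ≈ H.F₁ id · c
      idHom = begin
        c · id      ≈⟨ identityʳ ⟩
        c           ≈⟨ identityˡ ⟨
        id · c      ≈⟨ ·-resp-≈ˡ H.identity ⟨
        H.F₁ id · c ∎

  c·c⁻¹≈id : c · c⁻¹ ≈ id
  c·c⁻¹≈id = begin
    c · c⁻¹             ≈⟨ unfold-hom (H.F₁ c) ⟩
    H.F₁ c⁻¹ · H.F₁ c   ≈⟨ H.homomorphism ⟨
    H.F₁ (c⁻¹ · c)      ≈⟨ H.F-resp-≈ c⁻¹·c≈id ⟩
    H.F₁ id             ≈⟨ H.identity ⟩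
    id                  ∎
    where open HomReasoning

record FreeAlgebras {𝒜 : Category o h r} (K : Endofunctor 𝒜) : Set (o ⊔ h ⊔ r) where
  open Category 𝒜
  private module K = Functor K
  field
    M₀ : Obj → Obj
    φ  : ∀ X → K.F₀ (M₀ X) ⇒ M₀ X
    η  : ∀ X → X ⇒ M₀ X
    extend        : ∀ {X A} → K.F₀ A ⇒ A → X ⇒ A → M₀ X ⇒ A
    extend-hom    : ∀ {X A} (a : K.F₀ A ⇒ A) (f : X ⇒ A) →
                    IsAlgebraHom K (φ X) a (extend a f)
    extend-η      : ∀ {X A} (a : K.F₀ A ⇒ A) (f : X ⇒ A) → extend a f · η X ≈ f
    extend-unique : ∀ {X A} (a : K.F₀ A ⇒ A) (f : X ⇒ A) {g : M₀ X ⇒ A} →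
                    IsAlgebraHom K (φ X) a g → g · η X ≈ f → extend a f ≈ g

  infix 10 _♯
  _♯ : ∀ {A} → K.F₀ A ⇒ A → M₀ A ⇒ A
  a ♯ = extend a id

  M₁ : ∀ {X Y} → X ⇒ Y → M₀ X ⇒ M₀ Y
  M₁ {Y = Y} f = extend (φ Y) (η Y · f)

  M : Endofunctor 𝒜
  M = record
    { F₀ = M₀
    ; F₁ = M₁
    ; F-resp-≈ = λ {_} {Y} {f} {g} p → extend-unique (φ Y) (η Y · f)
        (extend-hom (φ Y) (η Y · g))
        (Equiv.trans (extend-η (φ Y) (η Y · g)) (·-resp-≈ʳ (Equiv.sym p)))
    ; identity = λ {X} → extend-unique (φ X) (η X · id)
        (Equiv.trans identityˡ
          (Equiv.sym (Equiv.trans (·-resp-≈ʳ K.identity) identityʳ)))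
        (Equiv.trans identityˡ (Equiv.sym identityʳ))
    ; homomorphism = λ {X} {Y} {Z} {f} {g} → extend-unique (φ Z) (η Z · (g · f))
        (begin
          (M₁ g · M₁ f) · φ X              ≈⟨ assoc ⟩
          M₁ g · (M₁ f · φ X)              ≈⟨ ·-resp-≈ʳ (extend-hom (φ Y) (η Y · f)) ⟩
          M₁ g · (φ Y · K.F₁ (M₁ f))       ≈⟨ assoc ⟨
          (M₁ g · φ Y) · K.F₁ (M₁ f)       ≈⟨ ·-resp-≈ˡ (extend-hom (φ Z) (η Z · g)) ⟩
          (φ Z · K.F₁ (M₁ g)) · K.F₁ (M₁ f) ≈⟨ assoc ⟩
          φ Z · (K.F₁ (M₁ g) · K.F₁ (M₁ f)) ≈⟨ ·-resp-≈ʳ K.homomorphism ⟨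
          φ Z · K.F₁ (M₁ g · M₁ f)         ∎)
        (begin
          (M₁ g · M₁ f) · η X  ≈⟨ assoc ⟩
          M₁ g · (M₁ f · η X)  ≈⟨ ·-resp-≈ʳ (extend-η (φ Y) (η Y · f)) ⟩
          M₁ g · (η Y · f)     ≈⟨ assoc ⟨
          (M₁ g · η Y) · f     ≈⟨ ·-resp-≈ˡ (extend-η (φ Z) (η Z · g)) ⟩
          (η Z · g) · f        ≈⟨ assoc ⟩
          η Z · (g · f)        ∎)
    }
    where open HomReasoning

module _ {𝒜 : Category o h r} (products : BinaryProducts 𝒜)
         (H : Endofunctor 𝒜) {K : Endofunctor 𝒜} (free : FreeAlgebras K) where
  open BinaryProducts products
  open FreeAlgebras free

  GSOSRule : Set (o ⊔ h ⊔ r)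
  GSOSRule = NaturalTransformation (K ∘F (H ×F Id)) (H ∘F M)

module _ {𝒜 : Category o h r} (products : BinaryProducts 𝒜)
         {H : Endofunctor 𝒜} (terminal : TerminalCoalgebra H)
         {K : Endofunctor 𝒜} (free : FreeAlgebras K)
         (ℓ : GSOSRule products H free) where
  open Category 𝒜
  open BinaryProducts products
  open TerminalCoalgebra terminal
  open FreeAlgebras free
  private
    module H = Functor H
    module K = Functor K
    module ℓ = NaturalTransformation ℓ

  -- A morphism b with this property exists and is unique.
  IsInterpretation : K.F₀ C ⇒ C → Set r
  IsInterpretation b = c · b ≈ H.F₁ (b ♯) · ℓ.component C · K.F₁ ⟨ c , id ⟩

module _ {𝒜 : Category o h r} (H : Endofunctor 𝒜)
         {K : Endofunctor 𝒜} (free : FreeAlgebras K) where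
  open Category 𝒜
  private
    module H = Functor H
    module M = Functor (FreeAlgebras.M free)

  SandwichedEquation : Obj → Set h
  SandwichedEquation X = X ⇒ M.F₀ (H.F₀ (M.F₀ X))

module _ {𝒜 : Category o h r}
         {H : Endofunctor 𝒜} (terminal : TerminalCoalgebra H)
         {K : Endofunctor 𝒜} (free : FreeAlgebras K) where
  open Category 𝒜
  open TerminalCoalgebra terminal
  open FreeAlgebras free
  private
    module H = Functor H
    module K = Functor K
    module M = Functor M

  IsSolution : (b : K.F₀ C ⇒ C) {X : Obj} → SandwichedEquation H free X → X ⇒ C → Set r
  IsSolution b e e† =
    e† ≈ b ♯ · M.F₁ c⁻¹ · M.F₁ (H.F₁ (b ♯)) · M.F₁ (H.F₁ (M.F₁ e†)) · e

{-# OPTIONS --safe #-}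

-- Substituting g = c⁻¹ · H(b♯ · M e†) turns solutions e† of a sandwiched
-- equation e : X → MHMX into solutions of c · g = H(b♯ · M g) · d, where
-- d : HMX → HMHMX is H applied to the Kleisli extension of e.  An equation
-- d : Y → HMY extends along the rule ℓ to an H-coalgebra on MY.  A morphism g
-- solves d exactly when its extension b♯ · M g is a coalgebra homomorphism from
-- this coalgebra to C, so terminality gives uniqueness.  For existence, the
-- unique coalgebra homomorphism u : MY → C is a K-algebra homomorphism, because
-- b♯ · M u and u · μ are coalgebra homomorphisms MMY → C with the same domain.

module Submission where

open import Defs
open import Level using (Level)
open import Data.Product using (∃!; _,_)

module _ {o h r : Level} {𝒜 : Category o h r} where
  open Category 𝒜
  open HomReasoning

  -- Rebracketing, and composition of algebra and coalgebra homomorphisms.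

  pullˡ : ∀ {A B C D} {f : A ⇒ B} {g : B ⇒ C} {k : C ⇒ D} {m : B ⇒ D} →
          k · g ≈ m → k · g · f ≈ m · f
  pullˡ p = Equiv.trans (Equiv.sym assoc) (·-resp-≈ˡ p)

  pullʳ : ∀ {A B C D} {f : A ⇒ B} {g : B ⇒ C} {k : C ⇒ D} {m : A ⇒ C} →
          g · f ≈ m → (k · g) · f ≈ k · m
  pullʳ p = Equiv.trans assoc (·-resp-≈ʳ p)

  module _ (F : Endofunctor 𝒜) where
    open Functor F

    hom-∘ : ∀ {A B D} {a : F₀ A ⇒ A} {b : F₀ B ⇒ B} {d : F₀ D ⇒ D}
              {g : B ⇒ D} {f : A ⇒ B} →
            IsAlgebraHom F b d g → IsAlgebraHom F a b f → IsAlgebraHom F a d (g · f)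
    hom-∘ {a = a} {b} {d} {g} {f} q p = begin
      (g · f) · a       ≈⟨ pullʳ p ⟩
      g · b · F₁ f      ≈⟨ pullˡ q ⟩
      (d · F₁ g) · F₁ f ≈⟨ pullʳ (Equiv.sym homomorphism) ⟩
      d · F₁ (g · f)    ∎

    id-hom : ∀ {A} {a : F₀ A ⇒ A} → IsAlgebraHom F a a id
    id-hom = Equiv.trans identityˡ
      (Equiv.sym (Equiv.trans (·-resp-≈ʳ identity) identityʳ))

    coalgebraHom-∘ : ∀ {A B D} {a : A ⇒ F₀ A} {b : B ⇒ F₀ B} {d : D ⇒ F₀ D}
                       {g : B ⇒ D} {f : A ⇒ B} →
                     IsCoalgebraHom F b d g → IsCoalgebraHom F a b f →
                     IsCoalgebraHom F a d (g · f)
    coalgebraHom-∘ {a = a} {b} {d} {g} {f} q p = begin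
      d · g · f         ≈⟨ pullˡ q ⟩
      (F₁ g · b) · f    ≈⟨ pullʳ p ⟩
      F₁ g · F₁ f · a   ≈⟨ pullˡ (Equiv.sym homomorphism) ⟩
      F₁ (g · f) · a    ∎

  -- Pairing into products.

  module _ (products : BinaryProducts 𝒜) where
    open BinaryProducts products

    ⟨⟩-precompose : ∀ {A B Y Z} {f : Z ⇒ A} {g : Z ⇒ B} {k : Y ⇒ Z} →
                    ⟨ f , g ⟩ · k ≈ ⟨ f · k , g · k ⟩
    ⟨⟩-precompose = Equiv.sym (unique (pullˡ project₁) (pullˡ project₂))

    ⟨⟩-cong : ∀ {A B Z} {f f′ : Z ⇒ A} {g g′ : Z ⇒ B} →
              f ≈ f′ → g ≈ g′ → ⟨ f , g ⟩ ≈ ⟨ f′ , g′ ⟩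
    ⟨⟩-cong p q = unique (Equiv.trans project₁ (Equiv.sym p))
                         (Equiv.trans project₂ (Equiv.sym q))

    ×₁-⟨⟩ : ∀ {A A′ B B′ Z} {f : A ⇒ A′} {g : B ⇒ B′} {p : Z ⇒ A} {q : Z ⇒ B} →
            (f ×₁ g) · ⟨ p , q ⟩ ≈ ⟨ f · p , g · q ⟩
    ×₁-⟨⟩ = Equiv.trans ⟨⟩-precompose (⟨⟩-cong (pullʳ project₁) (pullʳ project₂))

  -- Fusion laws for extensions from free algebras.

  module _ {K : Endofunctor 𝒜} (free : FreeAlgebras K) where
    open FreeAlgebras free
    private module K = Functor K

    extend-cong : ∀ {X A} {a : K.F₀ A ⇒ A} {f g : X ⇒ A} → f ≈ g → extend a f ≈ extend a g
    extend-cong p = extend-unique _ _ (extend-hom _ _) (Equiv.trans (extend-η _ _) (Equiv.sym p))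

    -- Homomorphisms compose, so both sides are homomorphisms out of the free algebra that agree on
    -- generators.
    hom-extend : ∀ {X A B} {a : K.F₀ A ⇒ A} {b : K.F₀ B ⇒ B} {f : X ⇒ A} {g : A ⇒ B} →
                 IsAlgebraHom K a b g → g · extend a f ≈ extend b (g · f)
    hom-extend p = Equiv.sym
      (extend-unique _ _ (hom-∘ K p (extend-hom _ _)) (pullʳ (extend-η _ _)))

    extend-M₁ : ∀ {X Y A} {a : K.F₀ A ⇒ A} {g : Y ⇒ A} {f : X ⇒ Y} →
                extend a g · M₁ f ≈ extend a (g · f)
    extend-M₁ = Equiv.trans (hom-extend (extend-hom _ _)) (extend-cong (pullˡ (extend-η _ _)))

    ♯-M₁ : ∀ {X A} {a : K.F₀ A ⇒ A} {f : X ⇒ A} → a ♯ · M₁ f ≈ extend a f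
    ♯-M₁ = Equiv.trans extend-M₁ (extend-cong identityˡ)

    hom-♯ : ∀ {A B} {a : K.F₀ A ⇒ A} {b : K.F₀ B ⇒ B} {f : A ⇒ B} →
            IsAlgebraHom K a b f → f · a ♯ ≈ extend b f
    hom-♯ p = Equiv.trans (hom-extend p) (extend-cong identityʳ)

  -- Bialgebras for the rule, and lifting equations to free algebras.

  module _ (products : BinaryProducts 𝒜) (H : Endofunctor 𝒜)
           {K : Endofunctor 𝒜} (free : FreeAlgebras K)
           (ℓ : GSOSRule products H free) where
    open BinaryProducts products
    open FreeAlgebras free
    private
      module H = Functor H
      module K = Functor K
      module ℓ = NaturalTransformation ℓ

    -- For `a = b` and `k = c` this is exactly the condition that `b` is the interpretation of `ℓ`.
    IsBialgebra : ∀ {A} → K.F₀ A ⇒ A → A ⇒ H.F₀ A → Set r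
    IsBialgebra {A} a k = k · a ≈ H.F₁ (a ♯) · ℓ.component A · K.F₁ ⟨ k , id ⟩

    -- The rule reads states as well as behaviours. Keeping the state in a second component makes
    -- recursion along `ℓ` an ordinary extension from a free algebra.
    ruleAlgebra : ∀ {A} → K.F₀ A ⇒ A → K.F₀ (H.F₀ A × A) ⇒ H.F₀ A × A
    ruleAlgebra {A} a = ⟨ H.F₁ (a ♯) · ℓ.component A , a · K.F₁ π₂ ⟩

    bialgebra⇒hom : ∀ {A} {a : K.F₀ A ⇒ A} {k : A ⇒ H.F₀ A} →
                    IsBialgebra a k → IsAlgebraHom K a (ruleAlgebra a) ⟨ k , id ⟩
    bialgebra⇒hom {a = a} {k} p = begin
      ⟨ k , id ⟩ · a ≈⟨ ⟨⟩-precompose products ⟩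
      ⟨ k · a , id · a ⟩ ≈⟨ ⟨⟩-cong products (Equiv.trans p (Equiv.sym assoc)) second ⟩
      ⟨ (H.F₁ (a ♯) · ℓ.component _) · K.F₁ ⟨ k , id ⟩
      , (a · K.F₁ π₂) · K.F₁ ⟨ k , id ⟩ ⟩ ≈⟨ ⟨⟩-precompose products ⟨
      ruleAlgebra a · K.F₁ ⟨ k , id ⟩ ∎
      where
        second : id · a ≈ (a · K.F₁ π₂) · K.F₁ ⟨ k , id ⟩
        second = begin
          id · a                          ≈⟨ id-hom K ⟩
          a · K.F₁ id                     ≈⟨ ·-resp-≈ʳ (K.F-resp-≈ project₂) ⟨
          a · K.F₁ (π₂ · ⟨ k , id ⟩)      ≈⟨ ·-resp-≈ʳ K.homomorphism ⟩
          a · K.F₁ π₂ · K.F₁ ⟨ k , id ⟩   ≈⟨ assoc ⟨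
          (a · K.F₁ π₂) · K.F₁ ⟨ k , id ⟩ ∎

    -- On behaviours this combines `t · a ♯ ≈ b ♯ · M₁ t` with naturality of `ℓ`; on states it is
    -- the hypothesis on `t`.
    ruleAlgebra-map : ∀ {A B} {a : K.F₀ A ⇒ A} {b : K.F₀ B ⇒ B} {t : A ⇒ B} →
                      IsAlgebraHom K a b t →
                      IsAlgebraHom K (ruleAlgebra a) (ruleAlgebra b) (H.F₁ t ×₁ t)
    ruleAlgebra-map {A} {B} {a} {b} {t} p = begin
      (H.F₁ t ×₁ t) · ruleAlgebra a ≈⟨ ×₁-⟨⟩ products ⟩
      ⟨ H.F₁ t · H.F₁ (a ♯) · ℓ.component A , t · a · K.F₁ π₂ ⟩
        ≈⟨ ⟨⟩-cong products first second ⟩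
      ⟨ (H.F₁ (b ♯) · ℓ.component B) · K.F₁ (H.F₁ t ×₁ t)
      , (b · K.F₁ π₂) · K.F₁ (H.F₁ t ×₁ t) ⟩ ≈⟨ ⟨⟩-precompose products ⟨
      ruleAlgebra b · K.F₁ (H.F₁ t ×₁ t) ∎
      where
        first : H.F₁ t · H.F₁ (a ♯) · ℓ.component A
                ≈ (H.F₁ (b ♯) · ℓ.component B) · K.F₁ (H.F₁ t ×₁ t)
        first = begin
          H.F₁ t · H.F₁ (a ♯) · ℓ.component A ≈⟨ pullˡ (Equiv.sym H.homomorphism) ⟩
          H.F₁ (t · a ♯) · ℓ.component A
            ≈⟨ ·-resp-≈ˡ (H.F-resp-≈ (Equiv.trans (hom-♯ free p) (Equiv.sym (♯-M₁ free)))) ⟩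
          H.F₁ (b ♯ · M₁ t) · ℓ.component A           ≈⟨ ·-resp-≈ˡ H.homomorphism ⟩
          (H.F₁ (b ♯) · H.F₁ (M₁ t)) · ℓ.component A  ≈⟨ pullʳ (Equiv.sym (ℓ.natural t)) ⟩
          H.F₁ (b ♯) · ℓ.component B · K.F₁ (H.F₁ t ×₁ t) ≈⟨ assoc ⟨
          (H.F₁ (b ♯) · ℓ.component B) · K.F₁ (H.F₁ t ×₁ t) ∎
        second : t · a · K.F₁ π₂ ≈ (b · K.F₁ π₂) · K.F₁ (H.F₁ t ×₁ t)
        second = begin
          t · a · K.F₁ π₂                     ≈⟨ pullˡ p ⟩
          (b · K.F₁ t) · K.F₁ π₂              ≈⟨ pullʳ (Equiv.sym K.homomorphism) ⟩
          b · K.F₁ (t · π₂)                   ≈⟨ ·-resp-≈ʳ (K.F-resp-≈ project₂) ⟨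
          b · K.F₁ (π₂ · (H.F₁ t ×₁ t))       ≈⟨ ·-resp-≈ʳ K.homomorphism ⟩
          b · K.F₁ π₂ · K.F₁ (H.F₁ t ×₁ t)    ≈⟨ assoc ⟨
          (b · K.F₁ π₂) · K.F₁ (H.F₁ t ×₁ t)  ∎

    pairedLift : ∀ {Y} → Y ⇒ H.F₀ (M₀ Y) → M₀ Y ⇒ H.F₀ (M₀ Y) × M₀ Y
    pairedLift {Y} d = extend (ruleAlgebra (φ Y)) ⟨ d , η Y ⟩

    lift : ∀ {Y} → Y ⇒ H.F₀ (M₀ Y) → M₀ Y ⇒ H.F₀ (M₀ Y)
    lift d = π₁ · pairedLift d

    -- By `project₂`, `π₂` is a homomorphism from `ruleAlgebra (φ Y)` to `φ Y`. Hence the state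
    -- component is an endomorphism of the free algebra fixing generators, so the identity.
    pairedLift≈⟨lift,id⟩ : ∀ {Y} (d : Y ⇒ H.F₀ (M₀ Y)) → pairedLift d ≈ ⟨ lift d , id ⟩
    pairedLift≈⟨lift,id⟩ {Y} d = Equiv.sym (unique Equiv.refl (begin
      π₂ · pairedLift d              ≈⟨ hom-extend free project₂ ⟩
      extend (φ Y) (π₂ · ⟨ d , η Y ⟩) ≈⟨ extend-unique (φ Y) _ (id-hom K)
                                          (Equiv.trans identityˡ (Equiv.sym project₂)) ⟩
      id                             ∎))

    lift-η : ∀ {Y} (d : Y ⇒ H.F₀ (M₀ Y)) → lift d · η Y ≈ d
    lift-η d = Equiv.trans (pullʳ (extend-η _ _)) project₁

    lift-bialgebra : ∀ {Y} (d : Y ⇒ H.F₀ (M₀ Y)) → IsBialgebra (φ Y) (lift d)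
    lift-bialgebra {Y} d = begin
      lift d · φ Y ≈⟨ pullʳ (extend-hom _ _) ⟩
      π₁ · ruleAlgebra (φ Y) · K.F₁ (pairedLift d) ≈⟨ pullˡ project₁ ⟩
      (H.F₁ (φ Y ♯) · ℓ.component (M₀ Y)) · K.F₁ (pairedLift d) ≈⟨ assoc ⟩
      H.F₁ (φ Y ♯) · ℓ.component (M₀ Y) · K.F₁ (pairedLift d)
        ≈⟨ ·-resp-≈ʳ (·-resp-≈ʳ (K.F-resp-≈ (pairedLift≈⟨lift,id⟩ d))) ⟩
      H.F₁ (φ Y ♯) · ℓ.component (M₀ Y) · K.F₁ ⟨ lift d , id ⟩ ∎

    -- ⟨ k , id ⟩ · t and (H t × t) · ⟨ lift d , id ⟩, with t = extend a f, are
    -- K-algebra homomorphisms MY → HA × A that agree on generators.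
    extend-coalgebraHom : ∀ {Y A} {a : K.F₀ A ⇒ A} {k : A ⇒ H.F₀ A} {f : Y ⇒ A}
                            {d : Y ⇒ H.F₀ (M₀ Y)} →
                          IsBialgebra a k → k · f ≈ H.F₁ (extend a f) · d →
                          IsCoalgebraHom H (lift d) k (extend a f)
    extend-coalgebraHom {Y} {A} {a} {k} {f} {d} bialg p = begin
      k · t                               ≈⟨ pullˡ project₁ ⟨
      π₁ · ⟨ k , id ⟩ · t                 ≈⟨ ·-resp-≈ʳ agree ⟩
      π₁ · (H.F₁ t ×₁ t) · pairedLift d   ≈⟨ pullˡ project₁ ⟩
      (H.F₁ t · π₁) · pairedLift d        ≈⟨ assoc ⟩
      H.F₁ t · lift d                     ∎
      where
        t : M₀ Y ⇒ A
        t = extend a f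
        agree : ⟨ k , id ⟩ · t ≈ (H.F₁ t ×₁ t) · pairedLift d
        agree = begin
          ⟨ k , id ⟩ · t ≈⟨ hom-extend free (bialgebra⇒hom bialg) ⟩
          extend (ruleAlgebra a) (⟨ k , id ⟩ · f)
            ≈⟨ extend-cong free (Equiv.trans (⟨⟩-precompose products)
                 (⟨⟩-cong products p (Equiv.trans identityˡ (Equiv.sym (extend-η a f))))) ⟩
          extend (ruleAlgebra a) ⟨ H.F₁ t · d , t · η Y ⟩
            ≈⟨ extend-cong free (×₁-⟨⟩ products) ⟨
          extend (ruleAlgebra a) ((H.F₁ t ×₁ t) · ⟨ d , η Y ⟩)
            ≈⟨ hom-extend free (ruleAlgebra-map (extend-hom a f)) ⟨
          (H.F₁ t ×₁ t) · pairedLift d ∎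

  module _ {H : Endofunctor 𝒜} (terminal : TerminalCoalgebra H) where
    open TerminalCoalgebra terminal

    c-monic : ∀ {A} {f g : A ⇒ C} → c · f ≈ c · g → f ≈ g
    c-monic {f = f} {g} p = begin
      f           ≈⟨ identityˡ ⟨
      id · f      ≈⟨ pullˡ c⁻¹·c≈id ⟨
      c⁻¹ · c · f ≈⟨ ·-resp-≈ʳ p ⟩
      c⁻¹ · c · g ≈⟨ pullˡ c⁻¹·c≈id ⟩
      id · g      ≈⟨ identityˡ ⟩
      g           ∎

  -- Coalgebra homomorphisms into the interpreted terminal coalgebra.

  module _ (products : BinaryProducts 𝒜) {H : Endofunctor 𝒜} (terminal : TerminalCoalgebra H)
           {K : Endofunctor 𝒜} (free : FreeAlgebras K) (ℓ : GSOSRule products H free) where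
    open BinaryProducts products
    open TerminalCoalgebra terminal
    open FreeAlgebras free
    private
      module H = Functor H
      module K = Functor K
      module ℓ = NaturalTransformation ℓ

    module _ {b : K.F₀ C ⇒ C} (interp : IsInterpretation products terminal free ℓ b) where

      module _ {A : Obj} {a : K.F₀ A ⇒ A} {k : A ⇒ H.F₀ A}
               (bialg : IsBialgebra products H free ℓ a k) where

        private
          u : A ⇒ C
          u = unfold k

          -- The coalgebra `k` read as an equation; its lift equips `M₀ A` with a coalgebra
          -- structure.
          viaUnit : A ⇒ H.F₀ (M₀ A)
          viaUnit = H.F₁ (η A) · k

          H-extend-viaUnit : ∀ {B} (β : K.F₀ B ⇒ B) (f : A ⇒ B) →
                             H.F₁ (extend β f) · viaUnit ≈ H.F₁ f · k
          H-extend-viaUnit β f =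
            pullˡ (Equiv.trans (Equiv.sym H.homomorphism) (H.F-resp-≈ (extend-η β f)))

          -- Both sides are coalgebra homomorphisms from the lift of `viaUnit` to `c`: the left one
          -- because `b` is the interpretation, the right one because `a ♯` is a coalgebra
          -- homomorphism to `k`.
          unfold-♯ : extend b u ≈ u · a ♯
          unfold-♯ = Equiv.trans
            (Equiv.sym (unfold-unique (lift products H free ℓ viaUnit)
              (extend-coalgebraHom products H free ℓ interp
                (Equiv.trans (unfold-hom k) (Equiv.sym (H-extend-viaUnit b u))))))
            (unfold-unique (lift products H free ℓ viaUnit)
              (coalgebraHom-∘ H (unfold-hom k)
                (extend-coalgebraHom products H free ℓ bialg (begin
                  k · id                      ≈⟨ identityʳ ⟩
                  k                           ≈⟨ identityˡ ⟨
                  id · k                      ≈⟨ ·-resp-≈ˡ H.identity ⟨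
                  H.F₁ id · k                 ≈⟨ H-extend-viaUnit a id ⟨
                  H.F₁ (a ♯) · viaUnit        ∎))))

        unfold-algebraHom : IsAlgebraHom K a b u
        unfold-algebraHom = c-monic terminal (begin
          c · u · a                                  ≈⟨ pullˡ (unfold-hom k) ⟩
          (H.F₁ u · k) · a                           ≈⟨ pullʳ bialg ⟩
          H.F₁ u · H.F₁ (a ♯) · ℓ.component A · K.F₁ ⟨ k , id ⟩
            ≈⟨ pullˡ (Equiv.sym H.homomorphism) ⟩
          H.F₁ (u · a ♯) · ℓ.component A · K.F₁ ⟨ k , id ⟩
            -- Terminality moves `u` inside the evaluation of terms, where naturality of `ℓ` can
            -- carry it on to the arguments of the rule.
            ≈⟨ ·-resp-≈ˡ (H.F-resp-≈ (Equiv.trans (♯-M₁ free) unfold-♯)) ⟨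
          H.F₁ (b ♯ · M₁ u) · ℓ.component A · K.F₁ ⟨ k , id ⟩
            ≈⟨ ·-resp-≈ˡ H.homomorphism ⟩
          (H.F₁ (b ♯) · H.F₁ (M₁ u)) · ℓ.component A · K.F₁ ⟨ k , id ⟩
            ≈⟨ pullʳ (pullˡ (Equiv.sym (ℓ.natural u))) ⟩
          H.F₁ (b ♯) · (ℓ.component C · K.F₁ (H.F₁ u ×₁ u)) · K.F₁ ⟨ k , id ⟩
            ≈⟨ ·-resp-≈ʳ (pullʳ K-pair) ⟩
          H.F₁ (b ♯) · ℓ.component C · K.F₁ ⟨ c , id ⟩ · K.F₁ u
            ≈⟨ ·-resp-≈ʳ assoc ⟨
          H.F₁ (b ♯) · (ℓ.component C · K.F₁ ⟨ c , id ⟩) · K.F₁ u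
            ≈⟨ pullˡ (Equiv.sym interp) ⟩
          (c · b) · K.F₁ u                           ≈⟨ assoc ⟩
          c · b · K.F₁ u                             ∎)
          where
            K-pair : K.F₁ (H.F₁ u ×₁ u) · K.F₁ ⟨ k , id ⟩ ≈ K.F₁ ⟨ c , id ⟩ · K.F₁ u
            K-pair = begin
              K.F₁ (H.F₁ u ×₁ u) · K.F₁ ⟨ k , id ⟩ ≈⟨ K.homomorphism ⟨
              K.F₁ ((H.F₁ u ×₁ u) · ⟨ k , id ⟩)
                ≈⟨ K.F-resp-≈ (×₁-⟨⟩ products) ⟩
              K.F₁ ⟨ H.F₁ u · k , u · id ⟩
                ≈⟨ K.F-resp-≈ (⟨⟩-cong products (Equiv.sym (unfold-hom k))
                     (Equiv.trans identityʳ (Equiv.sym identityˡ))) ⟩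
              K.F₁ ⟨ c · u , id · u ⟩              ≈⟨ K.F-resp-≈ (⟨⟩-precompose products) ⟨
              K.F₁ (⟨ c , id ⟩ · u)                ≈⟨ K.homomorphism ⟩
              K.F₁ ⟨ c , id ⟩ · K.F₁ u             ∎

      -- Solutions correspond to coalgebra homomorphisms from `lift d` to `c`: extend along `b` in
      -- one direction, restrict along `η Y` in the other.
      equation-solution : ∀ {Y} (d : Y ⇒ H.F₀ (M₀ Y)) →
                          ∃! _≈_ (λ (g : Y ⇒ C) → c · g ≈ H.F₁ (extend b g) · d)
      equation-solution {Y} d = u · η Y , solves , unique-solution
        where
          d̄ : M₀ Y ⇒ H.F₀ (M₀ Y)
          d̄ = lift products H free ℓ d
          u : M₀ Y ⇒ C
          u = unfold d̄

          solves : c · u · η Y ≈ H.F₁ (extend b (u · η Y)) · d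
          solves = begin
            c · u · η Y         ≈⟨ pullˡ (unfold-hom d̄) ⟩
            (H.F₁ u · d̄) · η Y  ≈⟨ pullʳ (lift-η products H free ℓ d) ⟩
            H.F₁ u · d
              -- Being a `K`-algebra homomorphism, `u` is the extension of its own restriction to
              -- generators.
              ≈⟨ ·-resp-≈ˡ (H.F-resp-≈ (extend-unique b _
                   (unfold-algebraHom (lift-bialgebra products H free ℓ d)) Equiv.refl)) ⟨
            H.F₁ (extend b (u · η Y)) · d ∎

          unique-solution : ∀ {g} → c · g ≈ H.F₁ (extend b g) · d → u · η Y ≈ g
          unique-solution {g} p = begin
            u · η Y          ≈⟨ ·-resp-≈ˡ (unfold-unique d̄
                                  (extend-coalgebraHom products H free ℓ interp p)) ⟩
            extend b g · η Y ≈⟨ extend-η b g ⟩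
            g                ∎

  -- Reduction of sandwiched equations to equations of type `Y ⇒ H.F₀ (M₀ Y)`.

  module _ {H : Endofunctor 𝒜} (terminal : TerminalCoalgebra H)
           {K : Endofunctor 𝒜} (free : FreeAlgebras K) where
    open TerminalCoalgebra terminal
    open FreeAlgebras free
    private
      module H = Functor H
      module K = Functor K
      module M = Functor M

    -- Fusing the outer maps into one extension exposes `c⁻¹ · H.F₁ (extend b y)`, the new unknown
    -- on `H.F₀ (M₀ X)`.
    sandwiched-rhs : ∀ (b : K.F₀ C ⇒ C) {X} (e : SandwichedEquation H free X) (y : X ⇒ C) →
      b ♯ · M₁ c⁻¹ · M₁ (H.F₁ (b ♯)) · M₁ (H.F₁ (M₁ y)) · e
      ≈ extend b (c⁻¹ · H.F₁ (extend b y)) · e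
    sandwiched-rhs b e y = begin
      b ♯ · M₁ c⁻¹ · M₁ (H.F₁ (b ♯)) · M₁ (H.F₁ (M₁ y)) · e
        ≈⟨ pullˡ (♯-M₁ free) ⟩
      extend b c⁻¹ · M₁ (H.F₁ (b ♯)) · M₁ (H.F₁ (M₁ y)) · e
        ≈⟨ ·-resp-≈ʳ (pullˡ (Equiv.sym M.homomorphism)) ⟩
      extend b c⁻¹ · M₁ (H.F₁ (b ♯) · H.F₁ (M₁ y)) · e
        ≈⟨ pullˡ (extend-M₁ free) ⟩
      extend b (c⁻¹ · H.F₁ (b ♯) · H.F₁ (M₁ y)) · e
        ≈⟨ ·-resp-≈ˡ (extend-cong free (·-resp-≈ʳ
             (Equiv.trans (Equiv.sym H.homomorphism) (H.F-resp-≈ (♯-M₁ free))))) ⟩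
      extend b (c⁻¹ · H.F₁ (extend b y)) · e ∎

mainTheorem1 : ∀ {o h r} (𝒜 : Category o h r)
    (products : BinaryProducts 𝒜) (coproducts : BinaryCoproducts 𝒜)
    (H : Endofunctor 𝒜) (terminal : TerminalCoalgebra H)
    (K : Endofunctor 𝒜) (free : FreeAlgebras K)
    (ℓ : GSOSRule products H free) →
    let open Category 𝒜
        open TerminalCoalgebra terminal using (C)
    in (b : Functor.F₀ K C ⇒ C) → IsInterpretation products terminal free ℓ b →
       (X : Obj) (e : SandwichedEquation H free X) →
       ∃! _≈_ (λ (e† : X ⇒ C) → IsSolution terminal free b e e†)
mainTheorem1 𝒜 products coproducts H terminal K free ℓ b interp X e
  -- The equation solved here has variables `H.F₀ (M₀ X)`; precomposing the extension of its
  -- solution `g` with `e` gives the solution on `X`.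
  with equation-solution products terminal free ℓ interp
         (Functor.F₁ H (FreeAlgebras.extend free (FreeAlgebras.φ free _) e))
... | g , g-solves , g-unique = extend b g · e , solves , unique-solution
  where
    open Category 𝒜
    open HomReasoning
    open TerminalCoalgebra terminal
    open FreeAlgebras free
    module H = Functor H

    ê : M₀ X ⇒ M₀ (H.F₀ (M₀ X))
    ê = extend (φ _) e

    -- Since `extend b g′` is a homomorphism, extending its composite with `e` is the same as
    -- precomposing it with `ê`.
    H-extend : ∀ {y g′} → y ≈ extend b g′ · e →
               H.F₁ (extend b y) ≈ H.F₁ (extend b g′) · H.F₁ ê
    H-extend {y} {g′} p = begin
      H.F₁ (extend b y)                ≈⟨ H.F-resp-≈ (extend-cong free p) ⟩
      H.F₁ (extend b (extend b g′ · e)) ≈⟨ H.F-resp-≈ (hom-extend free (extend-hom b g′)) ⟨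
      H.F₁ (extend b g′ · ê)           ≈⟨ H.homomorphism ⟩
      H.F₁ (extend b g′) · H.F₁ ê      ∎

    solves : IsSolution terminal free b e (extend b g · e)
    solves = Equiv.sym (Equiv.trans (sandwiched-rhs terminal free b e _)
      (·-resp-≈ˡ (extend-cong free (begin
        c⁻¹ · H.F₁ (extend b (extend b g · e)) ≈⟨ ·-resp-≈ʳ (H-extend Equiv.refl) ⟩
        c⁻¹ · H.F₁ (extend b g) · H.F₁ ê       ≈⟨ ·-resp-≈ʳ g-solves ⟨
        c⁻¹ · c · g                            ≈⟨ pullˡ {𝒜 = 𝒜} c⁻¹·c≈id ⟩
        id · g                                 ≈⟨ identityˡ ⟩
        g                                      ∎))))

    unique-solution : ∀ {y} → IsSolution terminal free b e y → extend b g · e ≈ y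
    unique-solution {y} p = begin
      -- The given solution `y` yields a solution `g′` of the reduced equation, which must equal
      -- `g`; and `y` is recovered from `g′` by `y≈`.
      extend b g · e  ≈⟨ ·-resp-≈ˡ (extend-cong free (g-unique g′-solves)) ⟩
      extend b g′ · e ≈⟨ y≈ ⟨
      y               ∎
      where
        g′ : H.F₀ (M₀ X) ⇒ C
        g′ = c⁻¹ · H.F₁ (extend b y)
        y≈ : y ≈ extend b g′ · e
        y≈ = Equiv.trans p (sandwiched-rhs terminal free b e y)
        g′-solves : c · g′ ≈ H.F₁ (extend b g′) · H.F₁ ê
        g′-solves = begin
          c · g′                      ≈⟨ pullˡ {𝒜 = 𝒜} c·c⁻¹≈id ⟩
          id · H.F₁ (extend b y)      ≈⟨ identityˡ ⟩
          H.F₁ (extend b y)           ≈⟨ H-extend y≈ ⟩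
          H.F₁ (extend b g′) · H.F₁ ê ∎
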